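{- Let $n$ be a positive integer and suppose there exist two mutually orthogonal latin squares of order $n$ that have a common transversal. Let $\rho$ be an integer with $1 \le \rho \le n$. Then there exists a $(3n+\rho,4)$-packing with exactly $n\rho + D(\rho,4)$ blocks in which the largest partial parallel class has size $\rho$.
   Context: For integers $v \ge k \ge 2$, a $(v,k)$-packing is a pair $(X,\mathcal{B})$ where $X$ is a set of $v$ points and $\mathcal{B}$ is a set of $k$-subsets of $X$ (blocks) such that every pair of distinct points lies in at most one block. For integers $m \ge 0$, $D(m,k)$ denotes the maximum number of $k$-subsets of an $m$-set such that every pair of points lies in at most one of them (so $D(m,k)=0$ if $m<k$). A partial parallel class (PPC) is a set of pairwise disjoint blocks; its size is the number of blocks. "The largest PPC has size $\rho$" means the packing has a PPC of size $\rho$ but none of size $\rho+1$. A transversal of a latin square of order $n$ is a set of $n$ cells, one in each row and each column, containing $n$ distinct symbols; a common transversal of several latin squares is a set of cells that is a transversal of each of them. -}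

module Defs where

open import Data.Bool.Base using (Bool; true; false)
open import Data.Bool.Properties using () renaming (_≟_ to _≟ᵇ_)
open import Data.Fin.Base using (Fin; combine) renaming (zero to fzero; suc to fsuc)
open import Data.Fin.Properties using (combine-injective; injective⇒≤) renaming (_≟_ to _≟ᶠ_; all? to allFin?)
open import Data.Fin.Subset using (Subset; _∩_; Empty; ∣_∣) renaming (_∈_ to _∈ˢ_)
open import Data.Fin.Subset.Properties using (anySubset?) renaming (_∈?_ to _∈ˢ?_)
open import Data.List.Base using (List; []; _∷_; length; lookup; map)
open import Data.List.Membership.Propositional using (_∈_)
open import Data.List.Membership.Propositional.Properties using (∈-lookup)
open import Data.List.Relation.Unary.All as All using (All; []; _∷_)
open import Data.List.Relation.Unary.AllPairs using (AllPairs; []; _∷_)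
open import Data.List.Relation.Unary.Unique.Propositional using (Unique)
import Data.List.Relation.Unary.Unique.DecPropositional as UniqueDec
open import Data.Nat.Base using (ℕ; zero; suc; _^_; _≤_)
open import Data.Nat.Properties using (m≤n⇒m<n∨m≡n; ≤-pred; suc-injective) renaming (_≟_ to _≟ℕ_)
open import Data.Product.Base using (∃; _×_; _,_; proj₁; proj₂; uncurry)
open import Data.Product using (∃!)
open import Data.Sum.Base using (inj₁; inj₂)
open import Data.Vec.Base using ([]; _∷_)
open import Data.Vec.Properties using (≡-dec)
open import Function.Base using (_∘_)
open import Function.Definitions using (Bijective; Injective)
open import Relation.Binary.Definitions using (DecidableEquality)
open import Relation.Binary.PropositionalEquality using (_≡_; _≢_; refl; sym; cong)
open import Relation.Nullary using (¬_; Dec; yes; no; contradiction)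
open import Relation.Nullary.Decidable using (map′; _×-dec_; _→-dec_; ¬?)

-- The point set is Fin v, and a finite set is represented by a
-- repetition-free list (of blocks here, of cells in `IsTransversal`).
-- Only membership and length are ever used, so the order is immaterial.
record IsBlockSet {v : ℕ} (k : ℕ) (blocks : List (Subset v)) : Set where
  field
    distinct : Unique blocks
    size     : All (λ B → ∣ B ∣ ≡ k) blocks
    pairs    : ∀ x y → x ≢ y → ∀ {B C} → B ∈ blocks → C ∈ blocks →
               x ∈ˢ B → y ∈ˢ B → x ∈ˢ C → y ∈ˢ C → B ≡ C

record Packing (v k : ℕ) : Set where
  field
    2≤k        : 2 ≤ k
    k≤v        : k ≤ v
    blocks     : List (Subset v)
    isBlockSet : IsBlockSet k blocks

  open IsBlockSet isBlockSet public

  numBlocks : ℕ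
  numBlocks = length blocks

Disjoint : ∀ {v} → Subset v → Subset v → Set
Disjoint B C = Empty (B ∩ C)

-- `Disjoint` does not exclude B ≡ ∅, so distinctness is required separately.
record IsPPC {v k : ℕ} (P : Packing v k) (Bs : List (Subset v)) : Set where
  field
    distinct : Unique Bs
    blocks   : All (_∈ Packing.blocks P) Bs
    disjoint : AllPairs Disjoint Bs

HasPPC : ∀ {v k} → Packing v k → ℕ → Set
HasPPC P s = ∃ λ Bs → IsPPC P Bs × length Bs ≡ s

LargestPPCHasSize : ∀ {v k} → Packing v k → ℕ → Set
LargestPPCHasSize P s = HasPPC P s × ¬ HasPPC P (suc s)

-- Unlike in `Packing`, m < k is allowed, since D(m,k) must make sense then.
Attains : (m k d : ℕ) → Set
Attains m k d = ∃ λ (Bs : List (Subset m)) → IsBlockSet k Bs × length Bs ≡ d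

IsMaximum : (ℕ → Set) → ℕ → Set
IsMaximum P d = P d × (∀ e → P e → e ≤ d)

private

  _≟ˢ_ : ∀ {m} → DecidableEquality (Subset m)
  _≟ˢ_ = ≡-dec _≟ᵇ_

  isBlockSet? : ∀ {m} k (Bs : List (Subset m)) → Dec (IsBlockSet k Bs)
  isBlockSet? k Bs = map′ to from
    (UniqueDec.unique? _≟ˢ_ Bs ×-dec All.all? (λ B → ∣ B ∣ ≟ℕ k) Bs ×-dec
     allFin? λ x → allFin? λ y → ¬? (x ≟ᶠ y) →-dec
       All.all? (λ B → All.all? (λ C →
         (x ∈ˢ? B) →-dec (y ∈ˢ? B) →-dec (x ∈ˢ? C) →-dec (y ∈ˢ? C) →-dec
         (B ≟ˢ C)) Bs) Bs)
    where
    to : _ → IsBlockSet k Bs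
    to (u , s , p) = record
      { distinct = u
      ; size     = s
      ; pairs    = λ x y x≢y B∈ C∈ → All.lookup (All.lookup (p x y x≢y) B∈) C∈
      }
    from : IsBlockSet k Bs → _
    from b = distinct , size , λ x y x≢y →
      All.tabulate λ B∈ → All.tabulate λ C∈ → pairs x y x≢y B∈ C∈
      where open IsBlockSet b

  anyList? : ∀ {m} {P : List (Subset m) → Set} → (∀ Bs → Dec (P Bs)) →
             ∀ d → Dec (∃ λ Bs → P Bs × length Bs ≡ d)
  anyList? P? zero = map′ (λ p → [] , p , refl) (λ { ([] , p , _) → p }) (P? [])
  anyList? P? (suc d) = map′
    (λ { (B , Bs , p , eq) → B ∷ Bs , p , cong suc eq })
    (λ { (B ∷ Bs , p , eq) → B , Bs , p , suc-injective eq })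
    (anySubset? λ B → anyList? (P? ∘ (B ∷_)) d)

  code : ∀ {m} → Subset m → Fin (2 ^ m)
  code []           = fzero
  code (true  ∷ p)  = combine {2} fzero (code p)
  code (false ∷ p)  = combine {2} (fsuc fzero) (code p)

  code-injective : ∀ {m} → Injective _≡_ _≡_ (code {m})
  code-injective {_} {[]} {[]} _ = refl
  code-injective {_} {true ∷ p} {true ∷ q} eq =
    cong (true ∷_) (code-injective (proj₂ (combine-injective {2} fzero (code p) fzero (code q) eq)))
  code-injective {_} {false ∷ p} {false ∷ q} eq =
    cong (false ∷_) (code-injective (proj₂ (combine-injective {2} (fsuc fzero) (code p) (fsuc fzero) (code q) eq)))
  code-injective {_} {true ∷ p} {false ∷ q} eq
    with () ← proj₁ (combine-injective {2} fzero (code p) (fsuc fzero) (code q) eq)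
  code-injective {_} {false ∷ p} {true ∷ q} eq
    with () ← proj₁ (combine-injective {2} (fsuc fzero) (code p) fzero (code q) eq)

  lookup-injective : ∀ {A : Set} {xs : List A} → Unique xs → Injective _≡_ _≡_ (lookup xs)
  lookup-injective (_ ∷ _)  {fzero}  {fzero}  _  = refl
  lookup-injective (x∉ ∷ _) {fzero}  {fsuc j} eq =
    contradiction eq (All.lookup x∉ (∈-lookup j))
  lookup-injective (x∉ ∷ _) {fsuc i} {fzero}  eq =
    contradiction (sym eq) (All.lookup x∉ (∈-lookup i))
  lookup-injective (_ ∷ u)  {fsuc i} {fsuc j} eq = cong fsuc (lookup-injective u eq)

  attains⇒≤ : ∀ {m k} d → Attains m k d → d ≤ 2 ^ m
  attains⇒≤ _ (Bs , b , refl) =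
    injective⇒≤ {f = code ∘ lookup Bs}
      (lookup-injective (IsBlockSet.distinct b) ∘ code-injective)

  maximum : ∀ {P : ℕ → Set} → (∀ d → Dec (P d)) → P 0 →
            ∀ b → (∀ d → P d → d ≤ b) → ∃ (IsMaximum P)
  maximum P? p₀ zero    bound = zero , p₀ , bound
  maximum {P} P? p₀ (suc b) bound with P? (suc b)
  ... | yes p = suc b , p , bound
  ... | no ¬p = maximum P? p₀ b smaller
    where
    smaller : ∀ d → P d → d ≤ b
    smaller d p with m≤n⇒m<n∨m≡n (bound d p)
    ... | inj₁ d<1+b = ≤-pred d<1+b
    ... | inj₂ refl  = contradiction p ¬p

  attains-zero : ∀ m k → Attains m k 0
  attains-zero m k = [] , record { distinct = [] ; size = [] ; pairs = λ _ _ _ () } , refl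

  D-exists : ∀ m k → ∃ (IsMaximum (Attains m k))
  D-exists m k =
    maximum (anyList? (isBlockSet? k)) (attains-zero m k) (2 ^ m) attains⇒≤

-- D m k is the maximum d with `Attains m k d`; the private lemmas above only
-- show that it exists (decidability, and the bound 2 ^ m on the number of
-- subsets).
D : (m k : ℕ) → ℕ
D m k = proj₁ (D-exists m k)

D-isMaximum : ∀ m k → IsMaximum (Attains m k) (D m k)
D-isMaximum m k = proj₂ (D-exists m k)

record LatinSquare (n : ℕ) : Set where
  field
    entry : Fin n → Fin n → Fin n
    row   : ∀ i → Bijective _≡_ _≡_ (entry i)
    col   : ∀ j → Bijective _≡_ _≡_ (λ i → entry i j)

open LatinSquare public using (entry)

Cell : ℕ → Set
Cell n = Fin n × Fin n

Orthogonal : ∀ {n} → LatinSquare n → LatinSquare n → Set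
Orthogonal {n} L M =
  Bijective {A = Cell n} {B = Fin n × Fin n} _≡_ _≡_ λ (i , j) → entry L i j , entry M i j

record IsTransversal {n : ℕ} (L : LatinSquare n) (T : List (Cell n)) : Set where
  field
    distinct : Unique T
    size     : length T ≡ n
    row      : ∀ i → ∃! _≡_ λ j → (i , j) ∈ T
    col      : ∀ j → ∃! _≡_ λ i → (i , j) ∈ T
    symbols  : Unique (map (uncurry (entry L)) T)

IsCommonTransversal : ∀ {n} → List (LatinSquare n) → List (Cell n) → Set
IsCommonTransversal Ls T = All (λ L → IsTransversal L T) Ls

{-# OPTIONS --safe #-}
-- Take the rows, the columns and the symbols of L as 3n points, and the first
-- ρ symbols of M as ρ extra points.  Each cell carrying one of these symbols
-- in M gives a block of its row, column, L-symbol and M-symbol; each symbol of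
-- M occurs n times, so there are nρ such blocks.  Add a largest packing on the
-- extra points.  Every block contains an extra point, so disjoint blocks
-- number at most ρ, while the cells of the common transversal carrying the
-- first ρ symbols of M give ρ disjoint blocks.
module Submission where

open import Defs
open import Data.Bool.Base using (true; false)
open import Data.Fin.Base as Fin using (Fin; inject≤; combine; remQuot; splitAt; _↑ˡ_; _↑ʳ_)
open import Data.Fin.Properties using (pigeonhole; inject≤-injective; combine-remQuot; remQuot-combine; splitAt⁻¹-↑ˡ; splitAt⁻¹-↑ʳ) renaming (_≟_ to _≟ᶠ_)
open import Data.Fin.Subset using (Subset; ∣_∣; ⁅_⁆; Nonempty) renaming (_∈_ to _∈ˢ_; ⊥ to ∅)
open import Data.Fin.Subset.Properties using (∣⁅x⁆∣≡1; ∣⊥∣≡0; ∉⊥; x∈⁅x⁆; x∈⁅y⁆⇒x≡y; x∈p∩q⁺; x∈p∩q⁻; nonempty?; Empty-unique)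
open import Data.List.Base using (List; []; _∷_; length; lookup; map; tabulate) renaming (_++_ to _++ᴸ_)
open import Data.List.Properties using (length-map; length-++; length-tabulate)
open import Data.List.Membership.Propositional using (_∈_)
open import Data.List.Membership.Propositional.Properties using (∈-map⁺; ∈-map⁻; ∈-++⁺ˡ; ∈-++⁻; ∈-tabulate⁺; ∈-tabulate⁻; ∈-lookup)
open import Data.List.Membership.DecPropositional using (_∈?_)
open import Data.List.Relation.Binary.Disjoint.Propositional using () renaming (Disjoint to Disjointᴸ)
open import Data.List.Relation.Unary.All as All using (All; []; _∷_)
import Data.List.Relation.Unary.All.Properties as All
open import Data.List.Relation.Unary.Any using (here; there)
open import Data.List.Relation.Unary.AllPairs using (AllPairs; []; _∷_)
import Data.List.Relation.Unary.AllPairs.Properties as AllPairs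
open import Data.List.Relation.Unary.Unique.Propositional using (Unique)
import Data.List.Relation.Unary.Unique.Propositional.Properties as Unique
open import Data.Nat.Base using (ℕ; suc; _+_; _*_; _≤_; s≤s; s<s⁻¹; z≤n)
open import Data.Nat.Properties using (≮⇒≥; ≤-reflexive; <⇒≱; *-monoʳ-≤; +-mono-≤; n<1+n)
open import Data.Product.Base using (∃; ∃₂; _×_; _,_; proj₁; proj₂; uncurry)
open import Data.Product.Properties using (,-injectiveˡ; ,-injectiveʳ)
open import Data.Sum.Base using (_⊎_; inj₁; inj₂)
open import Data.Vec.Base using ([]; _∷_; _++_)
open import Data.Vec.Properties using (lookup-++ˡ; lookup-++ʳ; []=⇒lookup; lookup⇒[]=; ++-injectiveʳ)
open import Function.Base using (_∘_)
open import Relation.Binary.PropositionalEquality using (_≡_; _≢_; refl; sym; trans; cong; cong₂; subst)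
open import Relation.Nullary using (yes; no; contradiction)

private
  variable
    A : Set
    m n v k : ℕ

-- Pigeonhole arguments for lists

AllPairs-lookup : {R : A → A → Set} {xs : List A} → AllPairs R xs →
                  ∀ {i j} → i Fin.< j → R (lookup xs i) (lookup xs j)
AllPairs-lookup (Rx ∷ _)  {Fin.zero}  {Fin.suc j} _   = All.lookup Rx (∈-lookup j)
AllPairs-lookup (_ ∷ Rxs) {Fin.suc i} {Fin.suc j} i<j = AllPairs-lookup Rxs (s<s⁻¹ i<j)

-- If the list were longer than `n`, two positions `i < j` would get the same value of `f`, although
-- `R` holds between their entries. Used with `R` as inequality and as disjointness of blocks.
length-≤-by-choice : {R : A → A → Set} {xs : List A} → AllPairs R xs →
                     (f : Fin (length xs) → Fin n) →
                     (∀ {i j} → R (lookup xs i) (lookup xs j) → f i ≢ f j) →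
                     length xs ≤ n
length-≤-by-choice Rxs f f-sep = ≮⇒≥ λ n<len →
  let i , j , i<j , fi≡fj = pigeonhole n<len f in
  f-sep (AllPairs-lookup Rxs i<j) fi≡fj

Unique-length : {xs : List (Fin n)} → Unique xs → length xs ≤ n
Unique-length {xs = xs} u = length-≤-by-choice u (lookup xs) (λ x≢y → x≢y)

-- A missing `x` could be put in front of `xs`, giving a repetition-free list of length `n + 1` in
-- `Fin n`.
Unique-complete : {xs : List (Fin n)} → Unique xs → length xs ≡ n → ∀ x → x ∈ xs
Unique-complete {xs = xs} u len x with _∈?_ _≟ᶠ_ x xs
... | yes x∈ = x∈
... | no  x∉ = contradiction (≤-reflexive (sym len)) (<⇒≱ (Unique-length (All.¬Any⇒All¬ xs x∉ ∷ u)))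

-- Serves to recover a cell of a transversal from its symbol.
Unique-map-injective : {B : Set} {f : A → B} {xs : List A} → Unique (map f xs) →
                       ∀ {x y} → x ∈ xs → y ∈ xs → f x ≡ f y → x ≡ y
Unique-map-injective _ (here refl) (here refl) _ = refl
Unique-map-injective {f = f} (fx∉ ∷ _) (here refl) (there y∈) eq =
  contradiction eq (All.lookup fx∉ (∈-map⁺ f y∈))
Unique-map-injective {f = f} (fx∉ ∷ _) (there x∈) (here refl) eq =
  contradiction (sym eq) (All.lookup fx∉ (∈-map⁺ f x∈))
Unique-map-injective (_ ∷ u) (there x∈) (there y∈) eq = Unique-map-injective u x∈ y∈ eq

-- Subsets of a sum of two point sets

↑-cover : ∀ m {n} (x : Fin (m + n)) → (∃ λ i → i ↑ˡ n ≡ x) ⊎ (∃ λ j → m ↑ʳ j ≡ x)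
↑-cover m x with splitAt m x in eq
... | inj₁ i = inj₁ (i , splitAt⁻¹-↑ˡ eq)
... | inj₂ j = inj₂ (j , splitAt⁻¹-↑ʳ {m} eq)

∣p++q∣≡∣p∣+∣q∣ : (p : Subset m) (q : Subset n) → ∣ p ++ q ∣ ≡ ∣ p ∣ + ∣ q ∣
∣p++q∣≡∣p∣+∣q∣ []          q = refl
∣p++q∣≡∣p∣+∣q∣ (true  ∷ p) q = cong suc (∣p++q∣≡∣p∣+∣q∣ p q)
∣p++q∣≡∣p∣+∣q∣ (false ∷ p) q = ∣p++q∣≡∣p∣+∣q∣ p q

module _ (p : Subset m) {q : Subset n} where

  ∈-↑ˡ⁺ : ∀ {i} → i ∈ˢ p → i ↑ˡ n ∈ˢ p ++ q
  ∈-↑ˡ⁺ {i} i∈p = lookup⇒[]= _ _ (trans (lookup-++ˡ p q i) ([]=⇒lookup i∈p))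

  ∈-↑ˡ⁻ : ∀ {i} → i ↑ˡ n ∈ˢ p ++ q → i ∈ˢ p
  ∈-↑ˡ⁻ {i} i∈ = lookup⇒[]= _ _ (trans (sym (lookup-++ˡ p q i)) ([]=⇒lookup i∈))

  ∈-↑ʳ⁺ : ∀ {j} → j ∈ˢ q → m ↑ʳ j ∈ˢ p ++ q
  ∈-↑ʳ⁺ {j} j∈q = lookup⇒[]= _ _ (trans (lookup-++ʳ p q j) ([]=⇒lookup j∈q))

  ∈-↑ʳ⁻ : ∀ {j} → m ↑ʳ j ∈ˢ p ++ q → j ∈ˢ q
  ∈-↑ʳ⁻ {j} j∈ = lookup⇒[]= _ _ (trans (sym (lookup-++ʳ p q j)) ([]=⇒lookup j∈))

∈-∅++⁻ : {q : Subset n} {x : Fin (m + n)} → x ∈ˢ ∅ {m} ++ q → ∃ λ j → m ↑ʳ j ≡ x × j ∈ˢ q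
∈-∅++⁻ {m = m} {x = x} x∈ with ↑-cover m x
... | inj₁ (i , refl) = contradiction (∈-↑ˡ⁻ ∅ x∈) ∉⊥
... | inj₂ (j , refl) = j , refl , ∈-↑ʳ⁻ (∅ {m}) x∈

∣p∣≡1+n⇒Nonempty : (p : Subset m) → ∣ p ∣ ≡ suc n → Nonempty p
∣p∣≡1+n⇒Nonempty {m} p size with nonempty? p
... | yes ne = ne
... | no ¬ne with () ← trans (sym size) (trans (cong ∣_∣ (Empty-unique ¬ne)) (∣⊥∣≡0 m))

-- Assembling block sets

IsBlockSet-tabulate : (f : Fin m → Subset v) → (∀ c → ∣ f c ∣ ≡ k) →
                      (∀ {c d} → f c ≡ f d → c ≡ d) →
                      (∀ {x y c d} → x ≢ y → x ∈ˢ f c → y ∈ˢ f c → x ∈ˢ f d → y ∈ˢ f d → c ≡ d) →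
                      IsBlockSet k (tabulate f)
IsBlockSet-tabulate f size injective linear = record
  { distinct = Unique.tabulate⁺ injective
  ; size     = All.tabulate⁺ size
  ; pairs    = pairs
  }
  where
  pairs : ∀ x y → x ≢ y → ∀ {B C} → B ∈ tabulate f → C ∈ tabulate f →
          x ∈ˢ B → y ∈ˢ B → x ∈ˢ C → y ∈ˢ C → B ≡ C
  pairs x y x≢y B∈ C∈ xB yB xC yC with ∈-tabulate⁻ B∈ | ∈-tabulate⁻ C∈
  ... | c , refl | d , refl = cong f (linear x≢y xB yB xC yC)

IsBlockSet-pad : ∀ m {Bs : List (Subset n)} → IsBlockSet k Bs →
                 IsBlockSet k (map (∅ {m} ++_) Bs)
IsBlockSet-pad {n = n} m {Bs} isBS = record
  { distinct = Unique.map⁺ (++-injectiveʳ ∅ ∅) distinct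
  ; size     = All.map⁺ (All.map (λ {B} eq → trans (∣p++q∣≡∣p∣+∣q∣ (∅ {m}) B) (trans (cong (_+ ∣ B ∣) (∣⊥∣≡0 m)) eq)) size)
  ; pairs    = pairs′
  }
  where
  open IsBlockSet isBS
  pairs′ : ∀ x y → x ≢ y → ∀ {B C} → B ∈ map (∅ {m} ++_) Bs → C ∈ map (∅ {m} ++_) Bs →
           x ∈ˢ B → y ∈ˢ B → x ∈ˢ C → y ∈ˢ C → B ≡ C
  pairs′ x y x≢y B∈ C∈ xB yB xC yC
    with B′ , B′∈ , refl ← ∈-map⁻ (∅ ++_) B∈
       | C′ , C′∈ , refl ← ∈-map⁻ (∅ ++_) C∈
    with x′ , refl , xB′ ← ∈-∅++⁻ {m = m} xB
       | y′ , refl , yB′ ← ∈-∅++⁻ {m = m} yB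
    = cong (∅ ++_) (pairs x′ y′ (x≢y ∘ cong (m ↑ʳ_)) B′∈ C′∈ xB′ yB′
                      (∈-↑ʳ⁻ (∅ {m}) xC) (∈-↑ʳ⁻ (∅ {m}) yC))

-- A pair of distinct points on a block of each list is excluded by the last hypothesis. That
-- hypothesis alone would allow a block with at most one point to occur in both lists, so
-- disjointness of the lists is asked for as well.
IsBlockSet-++ : {Bs Cs : List (Subset v)} → IsBlockSet k Bs → IsBlockSet k Cs →
                Disjointᴸ Bs Cs →
                (∀ {B C x y} → B ∈ Bs → C ∈ Cs → x ∈ˢ B → y ∈ˢ B → x ∈ˢ C → y ∈ˢ C → x ≡ y) →
                IsBlockSet k (Bs ++ᴸ Cs)
IsBlockSet-++ {Bs = Bs} {Cs} isB isC disj cross = record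
  { distinct = Unique.++⁺ B.distinct C.distinct disj
  ; size     = All.++⁺ B.size C.size
  ; pairs    = pairs
  }
  where
  module B = IsBlockSet isB
  module C = IsBlockSet isC
  pairs : ∀ x y → x ≢ y → ∀ {B C} → B ∈ Bs ++ᴸ Cs → C ∈ Bs ++ᴸ Cs →
          x ∈ˢ B → y ∈ˢ B → x ∈ˢ C → y ∈ˢ C → B ≡ C
  pairs x y x≢y B∈ C∈ xB yB xC yC with ∈-++⁻ Bs B∈ | ∈-++⁻ Bs C∈
  ... | inj₁ B∈ | inj₁ C∈ = B.pairs x y x≢y B∈ C∈ xB yB xC yC
  ... | inj₁ B∈ | inj₂ C∈ = contradiction (cross B∈ C∈ xB yB xC yC) x≢y
  ... | inj₂ B∈ | inj₁ C∈ = contradiction (cross C∈ B∈ xC yC xB yB) x≢y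
  ... | inj₂ B∈ | inj₂ C∈ = C.pairs x y x≢y B∈ C∈ xB yB xC yC

-- Choose for each block of the class an index `p` with `f p` on it. Two disjoint blocks cannot
-- choose the same index, since `f p` would lie on both.
PPC-length : (P : Packing v k) (f : Fin n → Fin v) →
             All (λ B → ∃ λ p → f p ∈ˢ B) (Packing.blocks P) →
             ∀ {Bs} → IsPPC P Bs → length Bs ≤ n
PPC-length P f meets {Bs} isPPC =
  length-≤-by-choice disjoint (proj₁ ∘ meet) λ {i} {j} disj eq →
    disj (f (proj₁ (meet i)) ,
          x∈p∩q⁺ (proj₂ (meet i) , subst (λ p → f p ∈ˢ lookup Bs j) (sym eq) (proj₂ (meet j))))
  where
  open IsPPC isPPC
  meet : ∀ i → ∃ λ p → f p ∈ˢ lookup Bs i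
  meet i = All.lookup meets (All.lookup blocks (∈-lookup i))

-- Cells of a common transversal

module CommonTransversal {n} {L M : LatinSquare n} {T : List (Cell n)}
                         (TL : IsTransversal L T) (TM : IsTransversal M T) where

  open IsTransversal

  row-injective : ∀ {i j j′} → (i , j) ∈ T → (i , j′) ∈ T → j ≡ j′
  row-injective {i} c∈ d∈ = let _ , _ , unique = row TL i in trans (sym (unique c∈)) (unique d∈)

  col-injective : ∀ {i i′ j} → (i , j) ∈ T → (i′ , j) ∈ T → i ≡ i′
  col-injective {j = j} c∈ d∈ = let _ , _ , unique = col TL j in trans (sym (unique c∈)) (unique d∈)

  -- The `n` symbols of `M` along `T` are distinct, so they exhaust `Fin n`.
  cellOf : ∀ s → ∃₂ λ i j → (i , j) ∈ T × entry M i j ≡ s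
  cellOf s
    with (i , j) , c∈ , eq ← ∈-map⁻ (uncurry (entry M))
           (Unique-complete (symbols TM) (trans (length-map _ T) (size TM)) s)
    = i , j , c∈ , sym eq

-- Points and cell blocks

module Construction {n ρ} (ρ≤n : ρ ≤ n) (L M : LatinSquare n) (L⊥M : Orthogonal L M) where

  open LatinSquare using () renaming (row to row-bijective; col to col-bijective)

  data Point : Set where
    row col letter : Fin n → Point
    extra          : Fin ρ → Point

  point : Point → Fin (3 * n + ρ)
  point (row x)    = (x ↑ˡ _) ↑ˡ ρ
  point (col x)    = (n ↑ʳ (x ↑ˡ _)) ↑ˡ ρ
  -- `3 * n` unfolds to `n + (n + (n + 0))`, so an empty summand follows the third copy of `Fin n`.
  -- It returns as the absurd case of `point-surjective` and as the trailing `[]` in `block`.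
  point (letter x) = (n ↑ʳ (n ↑ʳ (x ↑ˡ 0))) ↑ˡ ρ
  point (extra x)  = 3 * n ↑ʳ x

  point-surjective : ∀ x → ∃ λ a → point a ≡ x
  point-surjective x with ↑-cover (3 * n) x
  ... | inj₂ (p , refl) = extra p , refl
  ... | inj₁ (y , refl) with ↑-cover n y
  ...   | inj₁ (i , refl) = row i , refl
  ...   | inj₂ (z , refl) with ↑-cover n z
  ...     | inj₁ (j , refl) = col j , refl
  ...     | inj₂ (w , refl) with ↑-cover n w
  ...       | inj₁ (s , refl) = letter s , refl
  ...       | inj₂ (() , _)

  -- The cells whose M-symbol is among the first ρ are indexed by their row
  -- and this symbol, which makes it evident that there are n * ρ of them.
  column : Fin n → Fin ρ → Fin n
  column i p = proj₁ (proj₂ (row-bijective M i) (inject≤ p ρ≤n))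

  entry-column : ∀ i p → entry M i (column i p) ≡ inject≤ p ρ≤n
  entry-column i p = proj₂ (proj₂ (row-bijective M i) (inject≤ p ρ≤n)) refl

  symbol : Fin n → Fin ρ → Fin n
  symbol i p = entry L i (column i p)

  block : Fin n → Fin ρ → Subset (3 * n + ρ)
  block i p = (⁅ i ⁆ ++ ⁅ column i p ⁆ ++ ⁅ symbol i p ⁆ ++ []) ++ ⁅ p ⁆

  -- Incidence with `block i p` in terms of labelled points: one equation for each kind of point, so
  -- that linearity becomes a case analysis on kinds.
  On : Fin n → Fin ρ → Point → Set
  On i p (row x)    = x ≡ i
  On i p (col x)    = x ≡ column i p
  On i p (letter x) = x ≡ symbol i p
  On i p (extra x)  = x ≡ p

  ∈-block⁻ : ∀ i p a → point a ∈ˢ block i p → On i p a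
  ∈-block⁻ i p (row x)    = x∈⁅y⁆⇒x≡y i ∘ ∈-↑ˡ⁻ ⁅ i ⁆ ∘ ∈-↑ˡ⁻ _
  ∈-block⁻ i p (col x)    =
    x∈⁅y⁆⇒x≡y _ ∘ ∈-↑ˡ⁻ ⁅ column i p ⁆ ∘ ∈-↑ʳ⁻ ⁅ i ⁆ ∘ ∈-↑ˡ⁻ _
  ∈-block⁻ i p (letter x) =
    x∈⁅y⁆⇒x≡y _ ∘ ∈-↑ˡ⁻ ⁅ symbol i p ⁆ ∘ ∈-↑ʳ⁻ ⁅ column i p ⁆ ∘ ∈-↑ʳ⁻ ⁅ i ⁆ ∘ ∈-↑ˡ⁻ _
  ∈-block⁻ i p (extra x)  =
    x∈⁅y⁆⇒x≡y _ ∘ ∈-↑ʳ⁻ (⁅ i ⁆ ++ ⁅ column i p ⁆ ++ ⁅ symbol i p ⁆ ++ [])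

  row∈block : ∀ i p → point (row i) ∈ˢ block i p
  row∈block i p = ∈-↑ˡ⁺ _ (∈-↑ˡ⁺ ⁅ i ⁆ (x∈⁅x⁆ i))

  extra∈block : ∀ i p → point (extra p) ∈ˢ block i p
  extra∈block i p = ∈-↑ʳ⁺ (⁅ i ⁆ ++ ⁅ column i p ⁆ ++ ⁅ symbol i p ⁆ ++ []) (x∈⁅x⁆ p)

  ∣block∣≡4 : ∀ i p → ∣ block i p ∣ ≡ 4
  ∣block∣≡4 i p
    rewrite ∣p++q∣≡∣p∣+∣q∣ (⁅ i ⁆ ++ ⁅ column i p ⁆ ++ ⁅ symbol i p ⁆ ++ []) ⁅ p ⁆
          | ∣p++q∣≡∣p∣+∣q∣ ⁅ i ⁆ (⁅ column i p ⁆ ++ ⁅ symbol i p ⁆ ++ [])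
          | ∣p++q∣≡∣p∣+∣q∣ ⁅ column i p ⁆ (⁅ symbol i p ⁆ ++ [])
          | ∣p++q∣≡∣p∣+∣q∣ ⁅ symbol i p ⁆ []
          | ∣⁅x⁆∣≡1 i | ∣⁅x⁆∣≡1 (column i p) | ∣⁅x⁆∣≡1 (symbol i p) | ∣⁅x⁆∣≡1 p = refl

  -- The row point and the extra point of a block already give back its index.
  block-injective : ∀ c d → uncurry block c ≡ uncurry block d → c ≡ d
  block-injective (i , p) (i′ , p′) eq = cong₂ _,_
    (∈-block⁻ i′ p′ (row i) (subst (point (row i) ∈ˢ_) eq (row∈block i p)))
    (∈-block⁻ i′ p′ (extra p) (subst (point (extra p) ∈ˢ_) eq (extra∈block i p)))

  -- Two points of different kinds determine the cell

  module _ {i i′ : Fin n} {p p′ : Fin ρ} where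

    col-extra : column i p ≡ column i′ p′ → p ≡ p′ → (i , p) ≡ (i′ , p′)
    -- A symbol occurs only once in a column of `M`.
    col-extra j≡ refl = cong (_, p) (proj₁ (col-bijective M (column i p)) (trans (entry-column i p)
      (trans (sym (entry-column i′ p)) (cong (entry M i′) (sym j≡)))))

    letter-extra : symbol i p ≡ symbol i′ p′ → p ≡ p′ → (i , p) ≡ (i′ , p′)
    -- Orthogonality enters here: the pair of symbols of `L` and `M` determines the cell.
    letter-extra s≡ refl = cong (_, p) (,-injectiveˡ (proj₁ L⊥M (cong₂ _,_ s≡
      (trans (entry-column i p) (sym (entry-column i′ p))))))

    row-col : i ≡ i′ → column i p ≡ column i′ p′ → (i , p) ≡ (i′ , p′)
    -- The cell is given, so its symbol in `M` is too, and this symbol is `p` embedded in `Fin n`.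
    row-col refl j≡ = cong (i ,_) (inject≤-injective ρ≤n ρ≤n p p′
      (trans (sym (entry-column i p)) (trans (cong (entry M i) j≡) (entry-column i p′))))

    row-letter : i ≡ i′ → symbol i p ≡ symbol i′ p′ → (i , p) ≡ (i′ , p′)
    row-letter refl s≡ = row-col refl (proj₁ (row-bijective L i) s≡)

    col-letter : column i p ≡ column i′ p′ → symbol i p ≡ symbol i′ p′ → (i , p) ≡ (i′ , p′)
    col-letter j≡ s≡ = row-col (proj₁ (col-bijective L (column i p))
      (trans s≡ (cong (entry L i′) (sym j≡)))) j≡

    -- A block has exactly one point of each kind, so distinct points on it differ in kind. Of the
    -- six pairs of kinds, row and extra form the index itself; the others are the five lemmas
    -- above, each used in both orders.
    On-linear : ∀ a b → a ≢ b → On i p a → On i p b → On i′ p′ a → On i′ p′ b → (i , p) ≡ (i′ , p′)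
    On-linear (row _)    (row _)    a≢b refl refl _ _ = contradiction refl a≢b
    On-linear (row _)    (col _)    _ refl refl e f = row-col e f
    On-linear (row _)    (letter _) _ refl refl e f = row-letter e f
    On-linear (row _)    (extra _)  _ refl refl e f = cong₂ _,_ e f
    On-linear (col _)    (row _)    _ refl refl e f = row-col f e
    On-linear (col _)    (col _)    a≢b refl refl _ _ = contradiction refl a≢b
    On-linear (col _)    (letter _) _ refl refl e f = col-letter e f
    On-linear (col _)    (extra _)  _ refl refl e f = col-extra e f
    On-linear (letter _) (row _)    _ refl refl e f = row-letter f e
    On-linear (letter _) (col _)    _ refl refl e f = col-letter f e
    On-linear (letter _) (letter _) a≢b refl refl _ _ = contradiction refl a≢b
    On-linear (letter _) (extra _)  _ refl refl e f = letter-extra e f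
    On-linear (extra _)  (row _)    _ refl refl e f = cong₂ _,_ f e
    On-linear (extra _)  (col _)    _ refl refl e f = col-extra f e
    On-linear (extra _)  (letter _) _ refl refl e f = letter-extra f e
    On-linear (extra _)  (extra _)  a≢b refl refl _ _ = contradiction refl a≢b

  block-linear : ∀ c d {x y} → x ≢ y → x ∈ˢ uncurry block c → y ∈ˢ uncurry block c →
                 x ∈ˢ uncurry block d → y ∈ˢ uncurry block d → c ≡ d
  block-linear (i , p) (i′ , p′) {x} {y} x≢y xc yc xd yd
    with a , refl ← point-surjective x | b , refl ← point-surjective y
    = On-linear a b (x≢y ∘ cong point)
        (∈-block⁻ i p a xc) (∈-block⁻ i p b yc) (∈-block⁻ i′ p′ a xd) (∈-block⁻ i′ p′ b yd)

  -- With `Fin (n * ρ)` in place of pairs as index set, `length-tabulate` yields the count of blocks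
  -- directly.
  cellBlock : Fin (n * ρ) → Subset (3 * n + ρ)
  cellBlock c = uncurry block (remQuot ρ c)

  remQuot-injective : {c d : Fin (n * ρ)} → remQuot ρ c ≡ remQuot ρ d → c ≡ d
  remQuot-injective {c} {d} eq = trans (sym (combine-remQuot {n} ρ c))
    (trans (cong (uncurry (combine {n})) eq) (combine-remQuot {n} ρ d))

  cellBlocks : List (Subset (3 * n + ρ))
  cellBlocks = tabulate cellBlock

  cellBlocks-isBlockSet : IsBlockSet 4 cellBlocks
  cellBlocks-isBlockSet = IsBlockSet-tabulate cellBlock
    (λ c → uncurry ∣block∣≡4 (remQuot ρ c))
    (λ eq → remQuot-injective (block-injective (remQuot ρ _) (remQuot ρ _) eq))
    (λ x≢y x∈ y∈ x∈′ y∈′ → remQuot-injective (block-linear _ _ x≢y x∈ y∈ x∈′ y∈′))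

  block∈cellBlocks : ∀ i p → block i p ∈ cellBlocks
  block∈cellBlocks i p = subst (λ c → uncurry block c ∈ cellBlocks) (remQuot-combine i p)
    (∈-tabulate⁺ {f = cellBlock} (combine i p))

  ∈-cellBlocks⁻ : ∀ {B} → B ∈ cellBlocks → ∃₂ λ i p → B ≡ block i p
  ∈-cellBlocks⁻ B∈ = let c , eq = ∈-tabulate⁻ B∈; i , p = remQuot ρ c in i , p , eq

  -- Adding a largest packing on the extra points

  maximumBlocks : List (Subset ρ)
  maximumBlocks = proj₁ (proj₁ (D-isMaximum ρ 4))

  maximumBlocks-isBlockSet : IsBlockSet 4 maximumBlocks
  maximumBlocks-isBlockSet = proj₁ (proj₂ (proj₁ (D-isMaximum ρ 4)))

  length-maximumBlocks : length maximumBlocks ≡ D ρ 4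
  length-maximumBlocks = proj₂ (proj₂ (proj₁ (D-isMaximum ρ 4)))

  extraBlocks : List (Subset (3 * n + ρ))
  extraBlocks = map (∅ ++_) maximumBlocks

  extraBlocks-isBlockSet : IsBlockSet 4 extraBlocks
  extraBlocks-isBlockSet = IsBlockSet-pad (3 * n) maximumBlocks-isBlockSet

  ∈-extraBlocks⁻ : ∀ {B x} → B ∈ extraBlocks → x ∈ˢ B → ∃ λ p → x ≡ point (extra p)
  ∈-extraBlocks⁻ B∈ x∈B
    with _ , _ , refl ← ∈-map⁻ (∅ ++_) B∈
    with p , refl , _ ← ∈-∅++⁻ {m = 3 * n} x∈B
    = p , refl

  -- The singleton of the extra point, padded by `∅` on the first `3 * n` points, contains the extra
  -- point but no row point.
  row≢extra : ∀ i p → point (row i) ≢ point (extra p)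
  row≢extra i p eq =
    ∉⊥ (∈-↑ˡ⁻ (∅ {3 * n}) (subst (_∈ˢ ∅ {3 * n} ++ ⁅ p ⁆) (sym eq) (∈-↑ʳ⁺ (∅ {3 * n}) (x∈⁅x⁆ p))))

  -- A cell block contains a row point, whereas blocks of `extraBlocks` have extra points only.
  cellBlocks-extraBlocks-disjoint : Disjointᴸ cellBlocks extraBlocks
  cellBlocks-extraBlocks-disjoint (B∈ , B∈′)
    with i , p , refl ← ∈-cellBlocks⁻ B∈
    with q , eq ← ∈-extraBlocks⁻ B∈′ (row∈block i p)
    = row≢extra i q eq

  -- Points shared with a block of `extraBlocks` are extra points, and a cell block has just one of
  -- these.
  cellBlocks-extraBlocks-linear :
    ∀ {B C x y} → B ∈ cellBlocks → C ∈ extraBlocks →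
    x ∈ˢ B → y ∈ˢ B → x ∈ˢ C → y ∈ˢ C → x ≡ y
  cellBlocks-extraBlocks-linear B∈ C∈ xB yB xC yC
    with i , p , refl ← ∈-cellBlocks⁻ B∈
    with q , refl ← ∈-extraBlocks⁻ C∈ xC | r , refl ← ∈-extraBlocks⁻ C∈ yC
    = cong (point ∘ extra) (trans (∈-block⁻ i p (extra q) xB) (sym (∈-block⁻ i p (extra r) yB)))

  allBlocks : List (Subset (3 * n + ρ))
  allBlocks = cellBlocks ++ᴸ extraBlocks

  length-allBlocks : length allBlocks ≡ n * ρ + D ρ 4
  length-allBlocks = trans (length-++ cellBlocks) (cong₂ _+_ (length-tabulate cellBlock)
    (trans (length-map (∅ ++_) maximumBlocks) length-maximumBlocks))

  allBlocks-isBlockSet : IsBlockSet 4 allBlocks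
  allBlocks-isBlockSet = IsBlockSet-++ cellBlocks-isBlockSet extraBlocks-isBlockSet
    cellBlocks-extraBlocks-disjoint cellBlocks-extraBlocks-linear

  allBlocks-meet-extra : All (λ B → ∃ λ p → point (extra p) ∈ˢ B) allBlocks
  allBlocks-meet-extra = All.++⁺
    (All.tabulate⁺ λ c → let i , p = remQuot ρ c in p , extra∈block i p)
    -- Such a block has four points, hence at least one, and padding makes it an extra point.
    (All.map⁺ (All.map (λ {B} size → let p , p∈B = ∣p∣≡1+n⇒Nonempty B size in p , ∈-↑ʳ⁺ (∅ {3 * n}) p∈B)
      (IsBlockSet.size maximumBlocks-isBlockSet)))

  -- Disjoint blocks from the common transversal

  module _ {T : List (Cell n)} (TL : IsTransversal L T) (TM : IsTransversal M T) where

    open CommonTransversal {L = L} {M} TL TM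

    transversalRow : Fin ρ → Fin n
    transversalRow p = proj₁ (cellOf (inject≤ p ρ≤n))

    transversalCell∈ : ∀ p → (transversalRow p , column (transversalRow p) p) ∈ T
    transversalCell∈ p = let i , j , c∈ , eq = cellOf (inject≤ p ρ≤n) in
      -- The column supplied by `cellOf` is `column i p`, because row `i` of `M` shows the symbol
      -- only once.
      subst (λ j → (i , j) ∈ T) (proj₁ (row-bijective M i) (trans eq (sym (entry-column i p)))) c∈

    transversalBlock : Fin ρ → Subset (3 * n + ρ)
    transversalBlock p = block (transversalRow p) p

    -- Cells of `T` that agree in row, column or `L`-symbol are equal. Equal cells carry the same
    -- symbol of `M`, which `row-col` turns into `p ≡ q`.
    On-transversal : ∀ {p q} a → On (transversalRow p) p a → On (transversalRow q) q a → p ≡ q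
    On-transversal {p} {q} (row _) refl i≡ =
      ,-injectiveʳ (row-col i≡ (row-injective (transversalCell∈ p)
        (subst (λ i → (i , column (transversalRow q) q) ∈ T) (sym i≡) (transversalCell∈ q))))
    On-transversal {p} {q} (col _) refl j≡ =
      ,-injectiveʳ (row-col (col-injective (transversalCell∈ p)
        (subst (λ j → (transversalRow q , j) ∈ T) (sym j≡) (transversalCell∈ q))) j≡)
    On-transversal {p} {q} (letter _) refl s≡ =
      let c≡ = Unique-map-injective (IsTransversal.symbols TL) (transversalCell∈ p) (transversalCell∈ q) s≡
      in ,-injectiveʳ (row-col (,-injectiveˡ c≡) (,-injectiveʳ c≡))
    On-transversal (extra _) refl p≡ = p≡

    transversalBlock-disjoint : ∀ {p q} → p ≢ q → Disjoint (transversalBlock p) (transversalBlock q)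
    transversalBlock-disjoint p≢q (x , x∈)
      with a , refl ← point-surjective x
      with x∈p , x∈q ← x∈p∩q⁻ _ _ x∈
      = p≢q (On-transversal a (∈-block⁻ _ _ a x∈p) (∈-block⁻ _ _ a x∈q))

  -- The packing and its largest partial parallel class

  packing : 1 ≤ n → 1 ≤ ρ → Packing (3 * n + ρ) 4
  packing 1≤n 1≤ρ = record
    { 2≤k        = s≤s (s≤s z≤n)
    -- Here 4 is read as `3 * 1 + 1`.
    ; k≤v        = +-mono-≤ (*-monoʳ-≤ 3 1≤n) 1≤ρ
    ; blocks     = allBlocks
    ; isBlockSet = allBlocks-isBlockSet
    }

  largestPPC : ∀ 1≤n 1≤ρ {T} → IsTransversal L T → IsTransversal M T →
               LargestPPCHasSize (packing 1≤n 1≤ρ) ρ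
  largestPPC 1≤n 1≤ρ TL TM =
    (tabulate (transversalBlock TL TM) , transversal-isPPC , length-tabulate (transversalBlock TL TM)) ,
    λ (Bs , isPPC , len) →
      <⇒≱ (n<1+n ρ) (subst (_≤ ρ) len (PPC-length P (point ∘ extra) allBlocks-meet-extra isPPC))
    where
    P : Packing (3 * n + ρ) 4
    P = packing 1≤n 1≤ρ
    transversal-isPPC : IsPPC P (tabulate (transversalBlock TL TM))
    transversal-isPPC = record
      { distinct = Unique.tabulate⁺ (λ {p} {q} eq →
          ,-injectiveʳ (block-injective (transversalRow TL TM p , p) (transversalRow TL TM q , q) eq))
      ; blocks   = All.tabulate⁺ λ p → ∈-++⁺ˡ (block∈cellBlocks (transversalRow TL TM p) p)
      ; disjoint = AllPairs.tabulate⁺ (transversalBlock-disjoint TL TM)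
      }

theorem2p4 : (n : ℕ) → 1 ≤ n →
    (∃₂ λ (L M : LatinSquare n) → Orthogonal L M × ∃ λ T → IsCommonTransversal (L ∷ M ∷ []) T) →
    (ρ : ℕ) → 1 ≤ ρ → ρ ≤ n →
    ∃ λ (P : Packing (3 * n + ρ) 4) →
    Packing.numBlocks P ≡ n * ρ + D ρ 4 × LargestPPCHasSize P ρ
theorem2p4 n 1≤n (L , M , L⊥M , T , TL ∷ TM ∷ []) ρ 1≤ρ ρ≤n =
  packing 1≤n 1≤ρ , length-allBlocks , largestPPC 1≤n 1≤ρ TL TM
  where open Construction ρ≤n L M L⊥M
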